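{- Let $G=(V,E)$ be a connected graph. Then $G$ is bipartite if and only if $\theta=\Theta$, where $\theta$ and $\Theta$ are Djokovi\'c's and Winkler's relations on the edge set $E$.
   Context: Graphs are simple, undirected, nonempty, and not necessarily finite; $d$ denotes the shortest-path distance in $G$. For adjacent vertices $a,b\in V$ put $W_{ab}=\{w\in V: d(w,a)<d(w,b)\}$. Djokovi\'c's relation $\theta$ on $E$: for edges $e=xy$ and $f$, $e\,\theta\, f$ if and only if $f$ joins a vertex in $W_{xy}$ with a vertex in $W_{yx}$. Winkler's relation $\Theta$ on $E$: for edges $e=xy$ and $f=uv$, $e\,\Theta\, f$ if and only if $d(x,u)+d(y,v)\neq d(x,v)+d(y,u)$. -}

module Defs where

open import Axiom.ExcludedMiddle using (ExcludedMiddle)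
open import Data.Bool.Base using (Bool)
open import Data.Nat.Base using (ℕ; zero; suc; _+_; _≤_; _<_)
open import Data.Nat.Induction using (<-rec)
open import Data.Nat.Properties using (≤-antisym; ≤-reflexive; ≤-trans; ≮⇒≥; +-comm)
open import Data.Product.Base using (∃; ∃-syntax; _×_; _,_; proj₁; proj₂; swap)
open import Data.Sum.Base as Sum using (_⊎_)
open import Level using (Level; _⊔_) renaming (suc to lsuc)
open import Relation.Binary.Construct.Closure.ReflexiveTransitive using (Star; ε; _◅_)
open import Relation.Binary.Core using (Rel)
open import Relation.Binary.Definitions using (Irreflexive; Symmetric)
open import Relation.Binary.PropositionalEquality.Core
  using (_≡_; _≢_; refl; sym; trans)
open import Relation.Nullary.Decidable.Core using (yes; no)
open import Relation.Unary using (Pred)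

record Graph (a ℓ : Level) : Set (lsuc (a ⊔ ℓ)) where
  infix 4 _~_
  field
    V        : Set a
    _~_      : Rel V ℓ
    ~-sym    : Symmetric _~_
    ~-irrefl : Irreflexive _≡_ _~_
    nonempty : V

module _ {a ℓ : Level} (G : Graph a ℓ) where
  open Graph G

  Walk : Rel V (a ⊔ ℓ)
  Walk = Star _~_

  length : ∀ {x y} → Walk x y → ℕ
  length ε       = zero
  length (_ ◅ w) = suc (length w)

  Connected : Set (a ⊔ ℓ)
  Connected = ∀ x y → Walk x y

  Bipartite : Set (a ⊔ ℓ)
  Bipartite = ∃ λ (side : V → Bool) → ∀ {x y} → x ~ y → side x ≢ side y

  -- A walk of minimal length repeats no vertex, so minimising over walks is the
  -- same as minimising over paths.
  record IsDistance (d : V → V → ℕ) : Set (a ⊔ ℓ) where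
    field
      attained : ∀ x y → ∃[ w ] length {x} {y} w ≡ d x y
      minimal  : ∀ {x y} (w : Walk x y) → d x y ≤ length w

  -- An undirected edge is given by either of its two orientations.  The relations
  -- below do not depend on the choice: see θ-reverseˡ/ʳ and Θ-reverseˡ/ʳ.
  record Edge : Set (a ⊔ ℓ) where
    constructor edge
    field
      {end₁ end₂} : V
      adjacent    : end₁ ~ end₂

  reverse : Edge → Edge
  reverse (edge x~y) = edge (~-sym x~y)

  module _ (d : V → V → ℕ) where

    W : V → V → Pred V _
    W a b w = d w a < d w b

    θ : Rel Edge _
    θ (edge {x} {y} _) (edge {u} {v} _) =
      (W x y u × W y x v) ⊎ (W x y v × W y x u)

    Θ : Rel Edge _
    Θ (edge {x} {y} _) (edge {u} {v} _) =
      d x u + d y v ≢ d x v + d y u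

    θ-reverseˡ : ∀ e f → θ e f → θ (reverse e) f
    θ-reverseˡ _ _ p = Sum.swap (Sum.map swap swap p)

    θ-reverseʳ : ∀ e f → θ e f → θ e (reverse f)
    θ-reverseʳ _ _ = Sum.swap

    Θ-reverseˡ : ∀ e f → Θ e f → Θ (reverse e) f
    Θ-reverseˡ (edge {x} {y} _) (edge {u} {v} _) p q =
      p (trans (+-comm (d x u) (d y v)) (trans (sym q) (+-comm (d y u) (d x v))))

    Θ-reverseʳ : ∀ e f → Θ e f → Θ e (reverse f)
    Θ-reverseʳ _ _ p q = p (sym q)

  -- The distance function is unique, and classically every connected graph has
  -- one.  It is not computable from the graph in general, so statements about
  -- "the" distance quantify over d with IsDistance d.
  distance-unique : ∀ {d d′} → IsDistance d → IsDistance d′ → ∀ x y → d x y ≡ d′ x y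
  distance-unique D D′ x y = ≤-antisym (below D D′) (below D′ D)
    where
    open IsDistance
    below : ∀ {d d′} → IsDistance d → IsDistance d′ → d x y ≤ d′ x y
    below D D′ with attained D′ x y
    ... | w , eq = ≤-trans (minimal D w) (≤-reflexive eq)

  distance-exists : ExcludedMiddle (a ⊔ ℓ) → Connected → ∃ IsDistance
  distance-exists em connected = (λ x y → length (proj₁ (shortest x y))) , record
    { attained = λ x y → proj₁ (shortest x y) , refl
    ; minimal  = λ {x} {y} → proj₂ (shortest x y)
    }
    where
    Shortest : V → V → Set (a ⊔ ℓ)
    Shortest x y = ∃ λ (w : Walk x y) → ∀ w′ → length w ≤ length w′

    shortest : ∀ x y → Shortest x y
    shortest x y = <-rec (λ n → (w : Walk x y) → length w ≡ n → Shortest x y)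
      step _ (connected x y) refl
      where
      step : ∀ n → (∀ {m} → m < n → (w : Walk x y) → length w ≡ m → Shortest x y) →
             (w : Walk x y) → length w ≡ n → Shortest x y
      step n rec w refl with em {∃ λ (w′ : Walk x y) → length w′ < length w}
      ... | yes (w′ , w′<w) = rec w′<w w′ refl
      ... | no  ¬shorter    = w , λ w′ → ≮⇒≥ (λ w′<w → ¬shorter (w′ , w′<w))

{-# OPTIONS --safe #-}
-- For an edge xy, all turns on whether a vertex can be equidistant from x and y.
-- In a bipartite graph none is, so d(x,·) − d(y,·) takes only the values ±1, and
-- both relations say that it takes different values at the ends of the other edge.
-- Conversely, if Θ ⊆ θ, then d(x,·) − d(y,·), which is nonzero at x, cannot vanish
-- first at the end v of an edge uv: xy Θ uv would hold, but v lies in neither W_xy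
-- nor W_yx.  Hence the parity of the distance to a fixed vertex is a 2-colouring.
module Submission where

open import Defs
open import Data.Bool.Base using (Bool; false; not)
open import Data.Bool.Properties using (¬-not; not-¬)
open import Data.Nat.Base using (ℕ; suc; _+_; _≤_; _<_)
open import Data.Nat.GeneralisedArithmetic using (fold)
open import Data.Nat.Properties
open import Data.Product.Base using (_,_)
open import Data.Sum.Base using (_⊎_; inj₁; inj₂)
open import Function.Bundles using (_⇔_; mk⇔)
open import Level using (Level)
open import Relation.Binary.Construct.Closure.ReflexiveTransitive using (ε; _◅_)
open import Relation.Binary.Core using (_⇒_) renaming (_⇔_ to _≐_)
open import Relation.Binary.Definitions using (tri<; tri≈; tri>)
open import Relation.Binary.PropositionalEquality
  using (_≡_; _≢_; refl; sym; trans; cong; cong₂; subst₂)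
open import Relation.Nullary.Negation using (contradiction)

≢∧within-1⇒suc : ∀ {m n} → m ≢ n → m ≤ suc n → n ≤ suc m → n ≡ suc m ⊎ m ≡ suc n
≢∧within-1⇒suc {m} {n} m≢n m≤1+n n≤1+m with <-cmp m n
... | tri< m<n _ _ = inj₁ (≤-antisym n≤1+m m<n)
... | tri≈ _ m≡n _ = contradiction m≡n m≢n
... | tri> _ _ n<m = inj₂ (≤-antisym m≤1+n n<m)

module _ {a ℓ : Level} (G : Graph a ℓ) where
  open Graph G

  -- In `Bool`, to differ is to be the negation, so each edge of a walk flips the colour and the end
  -- colours fix the parity of the length.
  side-walk : (side : V → Bool) → (∀ {x y} → x ~ y → side x ≢ side y) →
              ∀ {x y} (w : Walk G x y) → side x ≡ fold (side y) not (length G w)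
  side-walk side proper ε         = refl
  side-walk side proper (x~z ◅ w) =
    trans (¬-not (proper x~z)) (cong not (side-walk side proper w))

  module _ {d : V → V → ℕ} (D : IsDistance G d) where
    open IsDistance D

    d-refl : ∀ x → d x x ≡ 0
    d-refl x = n≤0⇒n≡0 (minimal ε)

    d-step : ∀ {x y} → x ~ y → ∀ z → d x z ≤ suc (d y z)
    d-step {y = y} x~y z with attained y z
    ... | w , eq = ≤-trans (minimal (x~y ◅ w)) (≤-reflexive (cong suc eq))

    -- Each edge is crossed backwards by `~-sym`. With `z` the start of a shortest walk, this yields
    -- `d-sym` without constructing the reversed walk.
    d-walk : ∀ {x y} (w : Walk G x y) z → d y z ≤ length G w + d x z
    d-walk ε z = ≤-refl
    d-walk {x} {y} (_◅_ {j = x′} x~x′ w) z = begin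
      d y z                     ≤⟨ d-walk w z ⟩
      length G w + d x′ z       ≤⟨ +-monoʳ-≤ (length G w) (d-step (~-sym x~x′) z) ⟩
      length G w + suc (d x z)  ≡⟨ +-suc (length G w) (d x z) ⟩
      suc (length G w + d x z)  ∎
      where open ≤-Reasoning

    d-sym : ∀ x y → d x y ≡ d y x
    d-sym x y = ≤-antisym (below x y) (below y x)
      where
      open ≤-Reasoning
      below : ∀ x y → d x y ≤ d y x
      below x y with attained y x
      ... | w , eq = begin
        d x y               ≤⟨ d-walk w y ⟩
        length G w + d y y  ≡⟨ cong₂ _+_ eq (d-refl y) ⟩
        d y x + 0           ≡⟨ +-identityʳ (d y x) ⟩
        d y x               ∎

    adjacent⇒d≢0 : ∀ {x y} → x ~ y → d x y ≢ 0
    adjacent⇒d≢0 {x} {y} x~y d≡0 with attained x y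
    ... | ε     , _  = ~-irrefl refl x~y
    ... | _ ◅ _ , eq = contradiction (trans eq d≡0) λ ()

    -- `W` measures from the vertex to the ends of the edge, `Θ` from those ends to the vertex;
    -- `d-sym` mediates.
    W⇒< : ∀ {x y u} → W G d x y u → d x u < d y u
    W⇒< {x} {y} {u} = subst₂ _<_ (d-sym u x) (d-sym u y)

    suc⇒W : ∀ {x y u} → d y u ≡ suc (d x u) → W G d x y u
    suc⇒W {x} {y} {u} eq = subst₂ _<_ (d-sym x u) (d-sym y u) (≤-reflexive (sym eq))

    -- Adding the two strict inequalities that `θ` provides makes one of the sums in `Θ` strictly
    -- smaller than the other.
    θ⇒Θ : θ G d ⇒ Θ G d
    θ⇒Θ {edge {x} {y} _} {edge {u} {v} _} (inj₁ (u∈Wxy , v∈Wyx)) eq =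
      <⇒≢ (+-mono-< (W⇒< u∈Wxy) (W⇒< v∈Wyx)) (trans eq (+-comm (d x v) (d y u)))
    θ⇒Θ {edge {x} {y} _} {edge {u} {v} _} (inj₂ (v∈Wxy , u∈Wyx)) eq =
      <⇒≢ (+-mono-< (W⇒< v∈Wxy) (W⇒< u∈Wyx)) (trans (sym eq) (+-comm (d x u) (d y v)))

    -- Shortest walks of equal length to `w` would give the adjacent `x` and `y` the same colour.
    bipartite⇒no-equidistant : Bipartite G → ∀ {x y} → x ~ y → ∀ w → d x w ≢ d y w
    bipartite⇒no-equidistant (side , proper) {x} {y} x~y w eq =
      proper x~y (trans (side-d x) (trans (cong (fold (side w) not) eq) (sym (side-d y))))
      where
      side-d : ∀ z → side z ≡ fold (side w) not (d z w)
      side-d z with attained z w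
      ... | p , len = trans (side-walk side proper p) (cong (fold (side w) not) len)

    -- Each of `u` and `v` is nearer, by exactly one, to `x` or to `y`. If both are nearer to the
    -- same end, the two sums in `Θ` coincide.
    no-equidistant⇒Θ⇒θ : (∀ {x y} → x ~ y → ∀ w → d x w ≢ d y w) → Θ G d ⇒ θ G d
    no-equidistant⇒Θ⇒θ d≢ {edge {x} {y} x~y} {edge {u} {v} _} uΘv
      with nearer u | nearer v
      where
      nearer : ∀ w → d y w ≡ suc (d x w) ⊎ d x w ≡ suc (d y w)
      nearer w = ≢∧within-1⇒suc (d≢ x~y w) (d-step x~y w) (d-step (~-sym x~y) w)
    ... | inj₁ p | inj₂ q = inj₁ (suc⇒W p , suc⇒W q)
    ... | inj₂ p | inj₁ q = inj₂ (suc⇒W q , suc⇒W p)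
    ... | inj₁ p | inj₁ q = contradiction eq uΘv
      where
      open ≤-Reasoning
      eq : d x u + d y v ≡ d x v + d y u
      eq = begin-equality
        d x u + d y v        ≡⟨ cong (d x u +_) q ⟩
        d x u + suc (d x v)  ≡⟨ +-comm (d x u) (suc (d x v)) ⟩
        suc (d x v + d x u)  ≡⟨ +-suc (d x v) (d x u) ⟨
        d x v + suc (d x u)  ≡⟨ cong (d x v +_) p ⟨
        d x v + d y u        ∎
    ... | inj₂ p | inj₂ q = contradiction eq uΘv
      where
      open ≤-Reasoning
      eq : d x u + d y v ≡ d x v + d y u
      eq = begin-equality
        d x u + d y v        ≡⟨ cong (_+ d y v) p ⟩
        suc (d y u + d y v)  ≡⟨ cong suc (+-comm (d y u) (d y v)) ⟩
        suc (d y v + d y u)  ≡⟨ cong (_+ d y u) q ⟨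
        d x v + d y u        ∎

    module _ (Θ⇒θ : Θ G d ⇒ θ G d) where

      -- The start `u` is arbitrary so that the induction can advance it along the walk; it is used
      -- with `u` equal to `x`.
      not-equidistant-walk : ∀ {x y u w} → x ~ y → d x u ≢ d y u →
                             Walk G u w → d x w ≢ d y w
      not-equidistant-walk x~y u≢ ε = u≢
      not-equidistant-walk {x} {y} {u} x~y u≢ (_◅_ {j = v} u~v p) =
        not-equidistant-walk x~y v≢ p
        where
        v≢ : d x v ≢ d y v
        v≢ eq with Θ⇒θ {edge x~y} {edge u~v} xyΘuv
          where
          xyΘuv : Θ G d (edge x~y) (edge u~v)
          -- With `v` equidistant, equal sums would cancel to make `u` equidistant too.
          xyΘuv sums = u≢ (+-cancelʳ-≡ (d y v) (d x u) (d y u)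
            (trans sums (trans (cong (_+ d y u) eq) (+-comm (d y v) (d y u)))))
        ... | inj₁ (_ , v∈Wyx) = <⇒≢ (W⇒< v∈Wyx) (sym eq)
        ... | inj₂ (v∈Wxy , _) = <⇒≢ (W⇒< v∈Wxy) eq

      Θ⇒θ⇒bipartite : Connected G → Bipartite G
      Θ⇒θ⇒bipartite connected = side , proper
        where
        side : V → Bool
        -- The base vertex and its colour `false` are arbitrary choices.
        side x = fold false not (d x nonempty)

        proper : ∀ {x y} → x ~ y → side x ≢ side y
        proper {x} {y} x~y eq
          -- Non-equidistance is carried from `x` to the base vertex, so the distances of `x` and
          -- `y` to it differ by exactly one and have opposite parities.
          with ≢∧within-1⇒suc
                 (not-equidistant-walk x~y x≢ (connected x nonempty))
                 (d-step x~y nonempty) (d-step (~-sym x~y) nonempty)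
          where
          x≢ : d x x ≢ d y x
          x≢ xx≡yx = adjacent⇒d≢0 (~-sym x~y) (trans (sym xx≡yx) (d-refl x))
        ... | inj₁ p = not-¬ refl (trans eq (cong (fold false not) p))
        ... | inj₂ p = not-¬ refl (trans (sym eq) (cong (fold false not) p))

theorem3p2 : {a ℓ : Level} (G : Graph a ℓ) → Connected G →
    (d : Graph.V G → Graph.V G → ℕ) → IsDistance G d →
    Bipartite G ⇔ (θ G d ≐ Θ G d)
theorem3p2 G connected d D = mk⇔
  (λ b → (λ {e} {f} → θ⇒Θ G D {e} {f}) ,
         (λ {e} {f} → no-equidistant⇒Θ⇒θ G D (bipartite⇒no-equidistant G D b) {e} {f}))
  (λ (_ , Θ⇒θ) → Θ⇒θ⇒bipartite G D (λ {e} {f} → Θ⇒θ {e} {f}) connected)
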